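{- Let $A$ be a distributive lattice, let $\mathbb{S} = (A, \prec)$ be any subordination algebra and let $\mathbb{A} = (A, \mathbin{>\!\!=})$ be any slanted co-Heyting algebra. Then, for all $a,b,c \in A$: (i) $a\mathbin{>\!\!=}_{\prec} b \leq c$ if and only if $b \prec a \vee c$; (ii) $\mathbb{S}_\bullet = (A, \mathbin{>\!\!=}_{\prec})$ is a slanted co-Heyting algebra; (iii) $\mathbb{A}^\bullet = (A, \prec_{>\!\!=})$ is a subordination algebra; (iv) $a \prec_{>\!\!=_{\prec}} b$ if and only if $a\prec b$, and $a \mathbin{>\!\!=}_{\prec_{>\!\!=}} b = a\mathbin{>\!\!=} b$.
   Context: Lattices are bounded. For a lattice $A$, its canonical extension $A^\delta$ is the (unique up to isomorphism fixing $A$) complete lattice containing $A$ as a dense and compact sublattice. Here an element of $A^\delta$ is closed if it is $\bigwedge F$ for some nonempty $F\subseteq A$, and open if it is $\bigvee I$ for some nonempty $I\subseteq A$; $K(A^\delta)$ and $O(A^\delta)$ denote the sets of closed and open elements. Dense: every element of $A^\delta$ is both a join of closed elements and a meet of open elements. Compact: for all nonempty $F, I\subseteq A$, if $\bigwedge F\leq\bigvee I$ then $\bigwedge F'\leq \bigvee I'$ for some finite $F'\subseteq F$, $I'\subseteq I$. A subordination algebra is a pair $(A,\prec)$ where $A$ is a distributive lattice and ${\prec}\subseteq A\times A$ satisfies, for all $a,b,c,d\in A$: $\bot\prec\bot$ and $\top\prec\top$; if $a\prec b$ and $a\prec c$ then $a\prec b\wedge c$; if $a\prec c$ and $b\prec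 c$ then $a\vee b\prec c$; if $a\leq b\prec c\leq d$ then $a\prec d$. A slanted co-Heyting algebra is a pair $(A,\mathbin{>\!\!=})$ where $A$ is a distributive lattice and $>\!\!=\,: A\times A\to A^\delta$ is a binary operation (the symbol $>\!\!=$ is just its name) satisfying, for all $a,a_1,a_2,b,b_1,b_2,c\in A$: (1) $a\mathbin{>\!\!=} b\in K(A^\delta)$; (2) $a\mathbin{>\!\!=}(b_1\vee b_2)=(a\mathbin{>\!\!=} b_1)\vee(a\mathbin{>\!\!=} b_2)$ and $a\mathbin{>\!\!=}\bot=\bot$; (3) $(a_1\wedge a_2)\mathbin{>\!\!=} b=(a_1\mathbin{>\!\!=} b)\vee(a_2\mathbin{>\!\!=} b)$ and $\top\mathbin{>\!\!=} b=\bot$; (4) $a\mathbin{>\!\!=} b\leq c$ iff $\bot\mathbin{>\!\!=} b\leq a\vee c$. For a subordination algebra $(A,\prec)$, define $>\!\!=_{\prec}\,: A\times A\to A^\delta$ by $a\mathbin{>\!\!=}_{\prec} b:=\bigwedge\{c\in A\mid b\prec a\vee c\}$ (meet taken in $A^\delta$). For a slanted co-Heyting algebra $(A,\mathbin{>\!\!=})$, define the relation $\prec_{>\!\!=}$ on $A$ by: $a\prec_{>\!\!=} b$ iff $\bot\mathbin{>\!\!=} a\leq b$. The relation $\prec_{>\!\!=_\prec}$ is obtained by applying the second construction to $>\!\!=_{\prec}$, and $>\!\!=_{\prec_{>\!\!=}}$ by applying the first construction to $\prec_{>\!\!=}$. -}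

module Defs where

import Algebra.Definitions as Definitions
open import Algebra.Lattice.Bundles.Raw using (RawLattice)
open import Algebra.Lattice.Morphism.Structures using (module LatticeMorphisms)
open import Data.List.Base using (List; foldr)
open import Data.List.Relation.Unary.All using (All)
open import Data.Product.Base using (_×_; ∃-syntax)
open import Function.Bundles using (_⇔_)
open import Level using (Level; _⊔_; suc)
open import Relation.Binary.Core using (Rel)
open import Relation.Binary.Lattice.Bundles using (BoundedLattice)
open import Relation.Unary using (Pred; _∈_; _⊆_; Satisfiable)

record BoundedDistributiveLattice (a ℓ : Level) : Set (suc (a ⊔ ℓ)) where
  field
    boundedLattice : BoundedLattice a ℓ ℓ

  open BoundedLattice boundedLattice public
  open Definitions _≈_ using (_DistributesOverˡ_)

  field
    ∧-distribˡ-∨ : _∧_ DistributesOverˡ _∨_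

-- Subsets are predicates of a fixed level p.  They need not respect _≈_;
-- this does not affect their upper and lower bounds.
record CompleteLattice (c ℓ p : Level) : Set (suc (c ⊔ ℓ ⊔ p)) where
  field
    boundedLattice : BoundedLattice c ℓ ℓ

  open BoundedLattice boundedLattice public

  field
    ⋁          : Pred Carrier p → Carrier
    ⋁-upper    : ∀ {S x} → x ∈ S → x ≤ ⋁ S
    ⋁-least    : ∀ {S y} → (∀ {x} → x ∈ S → x ≤ y) → ⋁ S ≤ y
    ⋀          : Pred Carrier p → Carrier
    ⋀-lower    : ∀ {S x} → x ∈ S → ⋀ S ≤ x
    ⋀-greatest : ∀ {S y} → (∀ {x} → x ∈ S → y ≤ x) → y ≤ ⋀ S

rawLattice : ∀ {c ℓ₁ ℓ₂} → BoundedLattice c ℓ₁ ℓ₂ → RawLattice c ℓ₁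
rawLattice L = record { _≈_ = _≈_ ; _∧_ = _∧_ ; _∨_ = _∨_ }
  where open BoundedLattice L

-- The canonical extension is given by the properties characterising it up to
-- isomorphism.
record CanonicalExtension {a ℓ} (L : BoundedLattice a ℓ ℓ) (c : Level) :
       Set (suc (a ⊔ ℓ ⊔ c)) where
  private
    module L = BoundedLattice L

  field
    completeLattice : CompleteLattice c ℓ (a ⊔ ℓ)

  open CompleteLattice completeLattice public
  open LatticeMorphisms (rawLattice L) (rawLattice boundedLattice)
    using (IsLatticeMonomorphism)

  field
    ι                     : L.Carrier → Carrier
    isLatticeMonomorphism : IsLatticeMonomorphism ι
    ι-⊤                   : ι L.⊤ ≈ ⊤
    ι-⊥                   : ι L.⊥ ≈ ⊥

  ι[_] : Pred L.Carrier ℓ → Pred Carrier (a ⊔ ℓ)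
  ι[ F ] x = ∃[ y ] (y ∈ F × x ≈ ι y)

  IsClosed : Pred Carrier (a ⊔ suc ℓ)
  IsClosed x = ∃[ F ] (Satisfiable F × x ≈ ⋀ ι[ F ])

  IsOpen : Pred Carrier (a ⊔ suc ℓ)
  IsOpen x = ∃[ I ] (Satisfiable I × x ≈ ⋁ ι[ I ])

  field
    dense-closed : ∀ x → ∃[ S ] (S ⊆ IsClosed × x ≈ ⋁ S)
    dense-open   : ∀ x → ∃[ S ] (S ⊆ IsOpen × x ≈ ⋀ S)

    -- Finite subsets are lists; their meets and joins are computed in L.
    compact : ∀ (F I : Pred L.Carrier ℓ) → Satisfiable F → Satisfiable I →
              ⋀ ι[ F ] ≤ ⋁ ι[ I ] →
              ∃[ F′ ] ∃[ I′ ] (All F F′ × All I I′ ×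
                foldr L._∧_ L.⊤ F′ L.≤ foldr L._∨_ L.⊥ I′)

module _ {a ℓ} (A : BoundedDistributiveLattice a ℓ) where
  open BoundedDistributiveLattice A

  record IsSubordination (_≺_ : Rel Carrier ℓ) : Set (a ⊔ ℓ) where
    field
      ⊥≺⊥   : ⊥ ≺ ⊥
      ⊤≺⊤   : ⊤ ≺ ⊤
      ≺-∧   : ∀ {a b c} → a ≺ b → a ≺ c → a ≺ (b ∧ c)
      ∨-≺   : ∀ {a b c} → a ≺ c → b ≺ c → (a ∨ b) ≺ c
      ≤-≺-≤ : ∀ {a b c d} → a ≤ b → b ≺ c → c ≤ d → a ≺ d

module _ {a ℓ c} (A : BoundedDistributiveLattice a ℓ)
         (Aδ : CanonicalExtension (BoundedDistributiveLattice.boundedLattice A) c)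
         where
  private
    module A = BoundedDistributiveLattice A
    module Aδ = CanonicalExtension Aδ
  open Aδ using (ι; ι[_]; IsClosed)

  -- >=-cong says that _>=_ is an operation on A as a setoid.
  record IsSlantedCoHeyting (_>=_ : A.Carrier → A.Carrier → Aδ.Carrier) :
         Set (a ⊔ suc ℓ ⊔ c) where
    field
      >=-cong   : ∀ {a a′ b b′} → a A.≈ a′ → b A.≈ b′ →
                  (a >= b) Aδ.≈ (a′ >= b′)
      >=-closed : ∀ a b → IsClosed (a >= b)
      >=-∨      : ∀ a b₁ b₂ →
                  (a >= (b₁ A.∨ b₂)) Aδ.≈ ((a >= b₁) Aδ.∨ (a >= b₂))
      >=-⊥      : ∀ a → (a >= A.⊥) Aδ.≈ Aδ.⊥
      ∧->=      : ∀ a₁ a₂ b →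
                  ((a₁ A.∧ a₂) >= b) Aδ.≈ ((a₁ >= b) Aδ.∨ (a₂ >= b))
      ⊤->=      : ∀ b → (A.⊤ >= b) Aδ.≈ Aδ.⊥
      >=-≤      : ∀ a b c →
                  ((a >= b) Aδ.≤ ι c) ⇔ ((A.⊥ >= b) Aδ.≤ ι (a A.∨ c))

  ≺⇒>= : Rel A.Carrier ℓ → (A.Carrier → A.Carrier → Aδ.Carrier)
  ≺⇒>= _≺_ a b = Aδ.⋀ ι[ (λ c → b ≺ (a A.∨ c)) ]

  >=⇒≺ : (A.Carrier → A.Carrier → Aδ.Carrier) → Rel A.Carrier ℓ
  >=⇒≺ _>=_ a b = (A.⊥ >= a) Aδ.≤ ι b

{-# OPTIONS --safe #-}

-- The subset {c ∣ b ≺ a ∨ c} defining the meet a >=_≺ b is closed under finite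
-- meets, so by compactness an open element above that meet already lies above
-- some ι c with b ≺ a ∨ c.  For o = ι c this is (i).  Since every element is a
-- meet of open elements, it also lets the inequalities ≤ in the join
-- preservation laws of (ii) be checked one witness at a time.  The second half
-- of (iv) holds because a closed element is the meet of the elements of A
-- above it.
module Submission where

open import Defs
open import Algebra.Lattice.Morphism.Structures using (module LatticeMorphisms)
open import Data.List.Properties using (foldr-preservesᵇ)
import Data.List.Relation.Unary.All as All
open import Data.Product.Base using (_×_; _,_; ∃-syntax)
open import Function.Base using (_∘_)
open import Function.Bundles using (_⇔_; mk⇔; Equivalence)
open import Function.Construct.Composition using (_⇔-∘_)
open import Function.Construct.Symmetry using (⇔-sym)
open import Level using (_⊔_)
open import Relation.Binary.Core using (Rel)
open import Relation.Binary.Lattice.Bundles using (BoundedLattice; DistributiveLattice)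
import Relation.Binary.Lattice.Properties.BoundedJoinSemilattice as BoundedJoin
import Relation.Binary.Lattice.Properties.DistributiveLattice as Distributive
import Relation.Binary.Lattice.Properties.JoinSemilattice as Join
import Relation.Binary.Reasoning.PartialOrder as PosetReasoning
open import Relation.Unary using (Pred; _∈_; _⊆_)

-- Lets the finite meet supplied by compactness serve as a single member of `F`; `⊤-closed` covers
-- the empty list.
record ClosedUnderFiniteMeets {a ℓ} (L : BoundedLattice a ℓ ℓ)
       (F : Pred (BoundedLattice.Carrier L) ℓ) : Set (a ⊔ ℓ) where
  open BoundedLattice L
  field
    ⊤-closed : ⊤ ∈ F
    ∧-closed : ∀ {x y} → x ∈ F → y ∈ F → x ∧ y ∈ F

-- Consequences of density and compactness.

module CanonicalExtensionProperties {a ℓ c} {L : BoundedLattice a ℓ ℓ}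
         (Lδ : CanonicalExtension L c) where
  private module L = BoundedLattice L
  open CanonicalExtension Lδ
  open LatticeMorphisms (rawLattice L) (rawLattice boundedLattice)
  open IsLatticeMonomorphism isLatticeMonomorphism public
    using () renaming (∨-homo to ι-∨; ∧-homo to ι-∧; ⟦⟧-cong to ι-cong; injective to ι-injective)
  open PosetReasoning poset

  ι-mono : ∀ {x y} → x L.≤ y → ι x ≤ ι y
  ι-mono {x} {y} x≤y = begin
    ι x          ≤⟨ x≤x∨y _ _ ⟩
    ι x ∨ ι y    ≈⟨ ι-∨ x y ⟨
    ι (x L.∨ y)  ≈⟨ ι-cong (Join.x≤y⇒x∨y≈y L.joinSemilattice x≤y) ⟩
    ι y          ∎

  ι-cancel-≤ : ∀ {x y} → ι x ≤ ι y → x L.≤ y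
  ι-cancel-≤ {x} {y} ιx≤ιy = L.trans (L.x≤x∨y x y) (L.reflexive (ι-injective
    (Eq.trans (ι-∨ x y) (Join.x≤y⇒x∨y≈y joinSemilattice ιx≤ιy))))

  ι-∈ : ∀ {F : Pred L.Carrier ℓ} {x} → x ∈ F → ι x ∈ ι[ F ]
  ι-∈ x∈F = _ , x∈F , Eq.refl

  ⋀ι-lower : ∀ {F x} → x ∈ F → ⋀ ι[ F ] ≤ ι x
  ⋀ι-lower = ⋀-lower ∘ ι-∈

  ⋀ι-greatest : ∀ {F y} → (∀ {x} → x ∈ F → y ≤ ι x) → y ≤ ⋀ ι[ F ]
  ⋀ι-greatest lower = ⋀-greatest λ (_ , x∈F , z≈ιx) →
    ≤-respʳ-≈ (Eq.sym z≈ιx) (lower x∈F)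

  ⋀ι-anti : ∀ {F G} → F ⊆ G → ⋀ ι[ G ] ≤ ⋀ ι[ F ]
  ⋀ι-anti F⊆G = ⋀ι-greatest (⋀ι-lower ∘ F⊆G)

  ι-isOpen : ∀ x → IsOpen (ι x)
  -- The singleton up to `_≈_` has level `ℓ`, as `IsOpen` demands.
  ι-isOpen x = (L._≈ x) , (x , L.Eq.refl) ,
    antisym (⋁-upper (ι-∈ L.Eq.refl))
            (⋁-least λ (_ , y≈x , z≈ιy) → reflexive (Eq.trans z≈ιy (ι-cong y≈x)))

  -- Any `F` whose meet is `x` is contained in the set of all elements above `x`, so the meet of the
  -- larger set lies below `x`.
  closed≈⋀ : ∀ {x} → IsClosed x → ⋀ ι[ (λ y → x ≤ ι y) ] ≈ x
  closed≈⋀ {x} (F , _ , x≈⋀F) = antisym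
    (begin
      ⋀ ι[ (λ y → x ≤ ι y) ]  ≤⟨ ⋀ι-anti (≤-respˡ-≈ (Eq.sym x≈⋀F) ∘ ⋀ι-lower) ⟩
      ⋀ ι[ F ]                ≈⟨ x≈⋀F ⟨
      x                       ∎)
    (⋀ι-greatest λ x≤ιy → x≤ιy)

  -- By density `y` is a meet of open elements, each of them above `y` and hence above `x`.
  ≤-fromOpen : ∀ {x y} → (∀ {o} → IsOpen o → y ≤ o → x ≤ o) → x ≤ y
  ≤-fromOpen {x} {y} below with S , S⊆open , y≈⋀S ← dense-open y =
    ≤-respʳ-≈ (Eq.sym y≈⋀S)
      (⋀-greatest λ o∈S → below (S⊆open o∈S) (≤-respˡ-≈ (Eq.sym y≈⋀S) (⋀-lower o∈S)))

  ⋀≤open⇒∃ : ∀ {F o} → ClosedUnderFiniteMeets L F → IsOpen o → ⋀ ι[ F ] ≤ o →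
             ∃[ x ] (x ∈ F × ι x ≤ o)
  ⋀≤open⇒∃ {F} {o} F-closed (I , I-inhabited , o≈⋁I) ⋀F≤o
    with F′ , I′ , F′⊆F , I′⊆I , ⋀F′≤⋁I′ ←
      compact F I (L.⊤ , F-closed .ClosedUnderFiniteMeets.⊤-closed) I-inhabited (≤-respʳ-≈ o≈⋁I ⋀F≤o)
    -- The witness is the meet of `F′`.
    = _ , foldr-preservesᵇ ∧-closed ⊤-closed F′⊆F ,
      trans (ι-mono ⋀F′≤⋁I′)
        -- The elements of `L` below `o` form an ideal containing `I`, hence also the finite join of
        -- `I′`.
        (foldr-preservesᵇ {P = λ x → ι x ≤ o}
          (λ ιx≤o ιy≤o → ≤-respˡ-≈ (Eq.sym (ι-∨ _ _)) (∨-least ιx≤o ιy≤o))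
          (≤-respˡ-≈ (Eq.sym ι-⊥) (minimum o))
          (All.map (≤-respʳ-≈ (Eq.sym o≈⋁I) ∘ ⋁-upper ∘ ι-∈) I′⊆I))
    where open ClosedUnderFiniteMeets F-closed

  -- An open `o` above the right side is above both meets, hence above some `ι x` and `ι y` with
  -- `x ∈ F` and `y ∈ G`; then `x ∨ y`, a member of `H`, is below `o` too.
  ⋀≤⋀∨⋀ : ∀ {F G H} → ClosedUnderFiniteMeets L F → ClosedUnderFiniteMeets L G →
          (∀ {x y} → x ∈ F → y ∈ G → (x L.∨ y) ∈ H) →
          ⋀ ι[ H ] ≤ ⋀ ι[ F ] ∨ ⋀ ι[ G ]
  ⋀≤⋀∨⋀ {H = H} F-closed G-closed F∨G⊆H = ≤-fromOpen λ {o} o-open F∨G≤o →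
    let x , x∈F , ιx≤o = ⋀≤open⇒∃ F-closed o-open (trans (x≤x∨y _ _) F∨G≤o)
        y , y∈G , ιy≤o = ⋀≤open⇒∃ G-closed o-open (trans (y≤x∨y _ _) F∨G≤o)
    in begin
      ⋀ ι[ H ]     ≤⟨ ⋀ι-lower (F∨G⊆H x∈F y∈G) ⟩
      ι (x L.∨ y)  ≈⟨ ι-∨ x y ⟩
      ι x ∨ ι y    ≤⟨ ∨-least ιx≤o ιy≤o ⟩
      o            ∎

module _ {a ℓ c} (A : BoundedDistributiveLattice a ℓ)
         (Aδ : CanonicalExtension (BoundedDistributiveLattice.boundedLattice A) c)
         where
  private
    module A where
      open BoundedDistributiveLattice A public
      open Join joinSemilattice public
      open BoundedJoin boundedJoinSemilattice public

      distributiveLattice : DistributiveLattice a ℓ ℓ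
      distributiveLattice = record
        { isDistributiveLattice = record
          { isLattice = isLattice ; ∧-distribˡ-∨ = ∧-distribˡ-∨ } }

      open Distributive distributiveLattice public using (∨-distribˡ-∧; ∨-distribʳ-∧)

    module Aδ where
      open CanonicalExtension Aδ public
      open CanonicalExtensionProperties Aδ public
  open Aδ using (ι)

  -- From subordination algebras to slanted co-Heyting algebras.

  module Subordination {_≺_ : Rel A.Carrier ℓ} (≺-sub : IsSubordination A _≺_) where
    open IsSubordination ≺-sub

    private
      _>=_ : A.Carrier → A.Carrier → Aδ.Carrier
      _>=_ = ≺⇒>= A Aδ _≺_

    ≤-≺ : ∀ {x y z} → x A.≤ y → y ≺ z → x ≺ z
    ≤-≺ x≤y y≺z = ≤-≺-≤ x≤y y≺z A.refl

    ≺-≤ : ∀ {x y z} → x ≺ y → y A.≤ z → x ≺ z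
    ≺-≤ = ≤-≺-≤ A.refl

    ≺-resp-≈ : ∀ {x y z} → y A.≈ z → x ≺ y ⇔ x ≺ z
    ≺-resp-≈ y≈z = mk⇔ (λ x≺y → ≺-≤ x≺y (A.reflexive y≈z))
                       (λ x≺z → ≺-≤ x≺z (A.reflexive (A.Eq.sym y≈z)))

    ≺-⊤ : ∀ x → x ≺ A.⊤
    ≺-⊤ x = ≤-≺ (A.maximum x) ⊤≺⊤

    ⊥-≺ : ∀ x → A.⊥ ≺ x
    ⊥-≺ x = ≺-≤ ⊥≺⊥ (A.minimum x)

    ≺∨⊤ : ∀ a b → b ≺ (a A.∨ A.⊤)
    ≺∨⊤ a b = ≺-≤ (≺-⊤ b) (A.y≤x∨y _ _)

    -- Binary meets rest on distributivity: `(a ∨ x) ∧ (a ∨ y)` equals `a ∨ (x ∧ y)`.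
    ≺∨-closed : ∀ a b → ClosedUnderFiniteMeets A.boundedLattice (λ x → b ≺ (a A.∨ x))
    ≺∨-closed a b = record
      { ⊤-closed = ≺∨⊤ a b
      ; ∧-closed = λ b≺a∨x b≺a∨y →
          ≺-≤ (≺-∧ b≺a∨x b≺a∨y) (A.reflexive (A.Eq.sym (A.∨-distribˡ-∧ _ _ _)))
      }

    -- Since `ι c` is open, compactness yields `x ≤ c` with `b ≺ a ∨ x`, and `a ∨ x` can be enlarged
    -- to `a ∨ c`.
    >=-≤ι⇔≺∨ : ∀ a b c → ((a >= b) Aδ.≤ ι c) ⇔ (b ≺ (a A.∨ c))
    >=-≤ι⇔≺∨ a b c = mk⇔
      (λ a>=b≤c →
        let x , b≺a∨x , ιx≤ιc = Aδ.⋀≤open⇒∃ (≺∨-closed a b) (Aδ.ι-isOpen c) a>=b≤c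
        in ≺-≤ b≺a∨x (A.∨-monotonic A.refl (Aδ.ι-cancel-≤ ιx≤ιc)))
      Aδ.⋀ι-lower

    -- The case `a = ⊥` of (i), which is also the first half of (iv).
    ⊥>=-≤ι⇔≺ : ∀ b c → ((A.⊥ >= b) Aδ.≤ ι c) ⇔ (b ≺ c)
    ⊥>=-≤ι⇔≺ b c = ≺-resp-≈ (A.identityˡ c) ⇔-∘ >=-≤ι⇔≺∨ A.⊥ b c

    >=-mono : ∀ {a a′ b b′} → a′ A.≤ a → b A.≤ b′ → (a >= b) Aδ.≤ (a′ >= b′)
    >=-mono a′≤a b≤b′ = Aδ.⋀ι-anti λ b′≺a′∨x →
      ≤-≺-≤ b≤b′ b′≺a′∨x (A.∨-monotonic a′≤a A.refl)

    -- The hypothesis puts `⊥` itself into the set whose meet is taken.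
    >=≈⊥ : ∀ {a b} → b ≺ (a A.∨ A.⊥) → (a >= b) Aδ.≈ Aδ.⊥
    >=≈⊥ b≺a∨⊥ = Aδ.antisym
      (Aδ.≤-respʳ-≈ Aδ.ι-⊥ (Aδ.⋀ι-lower b≺a∨⊥)) (Aδ.minimum _)

    isSlantedCoHeyting : IsSlantedCoHeyting A Aδ _>=_
    isSlantedCoHeyting = record
      { >=-cong   = λ a≈a′ b≈b′ → Aδ.antisym
          (>=-mono (A.reflexive (A.Eq.sym a≈a′)) (A.reflexive b≈b′))
          (>=-mono (A.reflexive a≈a′) (A.reflexive (A.Eq.sym b≈b′)))
      ; >=-closed = λ a b → _ , (A.⊤ , ≺∨⊤ a b) , Aδ.Eq.refl
      ; >=-∨      = λ a b₁ b₂ → Aδ.antisym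
          -- Both `b₁` and `b₂` are subordinate to `a ∨ (x ∨ y)`, so their join is.
          (Aδ.⋀≤⋀∨⋀ (≺∨-closed a b₁) (≺∨-closed a b₂) λ b₁≺a∨x b₂≺a∨y →
            ∨-≺ (≺-≤ b₁≺a∨x (A.∨-monotonic A.refl (A.x≤x∨y _ _)))
                (≺-≤ b₂≺a∨y (A.∨-monotonic A.refl (A.y≤x∨y _ _))))
          (Aδ.∨-least (>=-mono A.refl (A.x≤x∨y _ _)) (>=-mono A.refl (A.y≤x∨y _ _)))
      ; >=-⊥      = λ a → >=≈⊥ (⊥-≺ _)
      ; ∧->=      = λ a₁ a₂ b → Aδ.antisym
          -- With `z = x ∨ y`, `b` is subordinate to `(a₁ ∨ z) ∧ (a₂ ∨ z)`, which distributivity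
          -- turns into `(a₁ ∧ a₂) ∨ z`.
          (Aδ.⋀≤⋀∨⋀ (≺∨-closed a₁ b) (≺∨-closed a₂ b) λ b≺a₁∨x b≺a₂∨y →
            ≺-≤ (≺-∧ (≺-≤ b≺a₁∨x (A.∨-monotonic A.refl (A.x≤x∨y _ _)))
                     (≺-≤ b≺a₂∨y (A.∨-monotonic A.refl (A.y≤x∨y _ _))))
                (A.reflexive (A.Eq.sym (A.∨-distribʳ-∧ _ _ _))))
          (Aδ.∨-least (>=-mono (A.x∧y≤x _ _) A.refl) (>=-mono (A.x∧y≤y _ _) A.refl))
      ; ⊤->=      = λ b → >=≈⊥ (≺-≤ (≺-⊤ b) (A.x≤x∨y _ _))
      -- By (i), both sides amount to `b ≺ a ∨ c`.
      ; >=-≤      = λ a b c → ⇔-sym (⊥>=-≤ι⇔≺ b (a A.∨ c)) ⇔-∘ >=-≤ι⇔≺∨ a b c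
      }

  -- From slanted co-Heyting algebras back to subordination algebras.

  module SlantedCoHeyting {_>=_ : A.Carrier → A.Carrier → Aδ.Carrier}
           (>=-slanted : IsSlantedCoHeyting A Aδ _>=_) where
    open IsSlantedCoHeyting >=-slanted
    open PosetReasoning Aδ.poset

    >=-monoʳ : ∀ {a b b′} → b A.≤ b′ → (a >= b) Aδ.≤ (a >= b′)
    >=-monoʳ {a} {b} {b′} b≤b′ = begin
      a >= b                  ≤⟨ Aδ.x≤x∨y _ _ ⟩
      (a >= b) Aδ.∨ (a >= b′) ≈⟨ >=-∨ a b b′ ⟨
      a >= (b A.∨ b′)         ≈⟨ >=-cong A.Eq.refl (A.x≤y⇒x∨y≈y b≤b′) ⟩
      a >= b′                 ∎

    isSubordination : IsSubordination A (>=⇒≺ A Aδ _>=_)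
    isSubordination = record
      { ⊥≺⊥   = Aδ.reflexive (Aδ.Eq.trans (>=-⊥ A.⊥) (Aδ.Eq.sym Aδ.ι-⊥))
      ; ⊤≺⊤   = Aδ.≤-respʳ-≈ (Aδ.Eq.sym Aδ.ι-⊤) (Aδ.maximum _)
      ; ≺-∧   = λ a≺b a≺c → Aδ.≤-respʳ-≈ (Aδ.Eq.sym (Aδ.ι-∧ _ _)) (Aδ.∧-greatest a≺b a≺c)
      ; ∨-≺   = λ a≺c b≺c → Aδ.≤-respˡ-≈ (Aδ.Eq.sym (>=-∨ _ _ _)) (Aδ.∨-least a≺c b≺c)
      ; ≤-≺-≤ = λ a≤b b≺c c≤d → Aδ.trans (>=-monoʳ a≤b) (Aδ.trans b≺c (Aδ.ι-mono c≤d))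
      }

    -- By `>=-≤`, the set whose meet is taken consists of the elements of `A` above `a >= b`; as
    -- `a >= b` is closed, it is their meet.
    ≺⇒>=-inverse : ∀ a b → ≺⇒>= A Aδ (>=⇒≺ A Aδ _>=_) a b Aδ.≈ (a >= b)
    ≺⇒>=-inverse a b = Aδ.Eq.trans
      (Aδ.antisym (Aδ.⋀ι-anti (Equivalence.to (>=-≤ a b _)))
                  (Aδ.⋀ι-anti (Equivalence.from (>=-≤ a b _))))
      (Aδ.closed≈⋀ (>=-closed a b))

proposition5p3 :
    ∀ {a ℓ c} (A : BoundedDistributiveLattice a ℓ)
    (Aδ : CanonicalExtension (BoundedDistributiveLattice.boundedLattice A) c) →
    let module A = BoundedDistributiveLattice A
        module Aδ = CanonicalExtension Aδ
    in
    (_≺_ : Rel A.Carrier ℓ) → IsSubordination A _≺_ →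
    (_>=_ : A.Carrier → A.Carrier → Aδ.Carrier) → IsSlantedCoHeyting A Aδ _>=_ →
    (∀ a b c → (≺⇒>= A Aδ _≺_ a b Aδ.≤ Aδ.ι c) ⇔ (b ≺ (a A.∨ c)))
    × IsSlantedCoHeyting A Aδ (≺⇒>= A Aδ _≺_)
    × IsSubordination A (>=⇒≺ A Aδ _>=_)
    × (∀ a b → >=⇒≺ A Aδ (≺⇒>= A Aδ _≺_) a b ⇔ (a ≺ b))
    × (∀ a b → ≺⇒>= A Aδ (>=⇒≺ A Aδ _>=_) a b Aδ.≈ (a >= b))
proposition5p3 A Aδ _≺_ ≺-sub _>=_ >=-slanted =
  >=-≤ι⇔≺∨ , isSlantedCoHeyting , isSubordination , ⊥>=-≤ι⇔≺ , ≺⇒>=-inverse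
  where
  open Subordination A Aδ ≺-sub
  open SlantedCoHeyting A Aδ >=-slanted
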